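{- Let $G$ be a generalized split graph (GSP graph). Then $p(G)\le 2$.
   Context: A graph $G$ is a GSP (generalized split) graph if either $G$ or its complement $\overline{G}$ has the following form: its vertex set is partitioned into $V_1,V_2$ where $V_1$ spans a complete graph and $V_2$ spans a disjoint union of complete graphs with no edges between them. A comparability graph is a graph admitting a transitive orientation. $p(G)$ is the minimum number $m$ such that $E(G)$ is the union of the edge sets of $m$ pairwise edge-disjoint comparability subgraphs of $G$. -}

module Defs where

open import Data.Fin.Base using (Fin)
open import Data.Fin.Subset using (Subset; _∈_; ∁)
open import Data.Nat.Base using (ℕ; _≤_)
open import Data.Product.Base using (Σ-syntax; ∃-syntax; _×_; _,_)
open import Data.Sum.Base using (_⊎_)
open import Function.Bundles using (_⇔_)
open import Level using (0ℓ)
open import Relation.Binary.Core using (Rel; _⇒_)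
open import Relation.Binary.Definitions
  using (Symmetric; Irreflexive; Asymmetric; Transitive; Decidable)
open import Relation.Binary.PropositionalEquality
  using (_≡_; _≢_; refl; ≢-sym)
open import Relation.Nullary.Decidable using (¬?; _×-dec_)
open import Relation.Nullary.Negation using (¬_)
import Data.Fin.Properties as Fin

-- Decidability of adjacency is automatic classically; constructively it is
-- what makes a graph on Fin n a finite object.
record Graph (n : ℕ) : Set₁ where
  field
    Edge  : Rel (Fin n) 0ℓ
    sym   : Symmetric Edge
    irr   : Irreflexive _≡_ Edge
    edge? : Decidable Edge

open Graph public using (Edge)

complement : ∀ {n} → Graph n → Graph n
complement G = record
  { Edge  = λ u v → u ≢ v × ¬ Edge G u v
  ; sym   = λ (u≢v , ¬uv) → ≢-sym u≢v , λ vu → ¬uv (Graph.sym G vu)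
  ; irr   = λ u≡v (u≢v , _) → u≢v u≡v
  ; edge? = λ u v → ¬? (u Fin.≟ v) ×-dec ¬? (Graph.edge? G u v)
  }

SpansComplete : ∀ {n} → Graph n → Subset n → Set
SpansComplete G S = ∀ {u v} → u ∈ S → v ∈ S → u ≢ v → Edge G u v

-- The function assigns to each vertex of S the index of its complete graph;
-- its values outside S are irrelevant.
SpansDisjointCompletes : ∀ {n} → Graph n → Subset n → Set
SpansDisjointCompletes {n} G S =
  Σ[ index ∈ (Fin n → ℕ) ]
    (∀ {u v} → u ∈ S → v ∈ S → u ≢ v → Edge G u v ⇔ index u ≡ index v)

HasSplitForm : ∀ {n} → Graph n → Set
HasSplitForm {n} G =
  Σ[ V₁ ∈ Subset n ] (SpansComplete G V₁ × SpansDisjointCompletes G (∁ V₁))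

GSP : ∀ {n} → Graph n → Set
GSP G = HasSplitForm G ⊎ HasSplitForm (complement G)

record TransitiveOrientation {n} (G : Graph n) : Set₁ where
  field
    Arc       : Rel (Fin n) 0ℓ
    arc⇒edge : Arc ⇒ Edge G
    orients   : ∀ {u v} → Edge G u v → Arc u v ⊎ Arc v u
    asym      : Asymmetric Arc
    trans     : Transitive Arc

IsComparabilityGraph : ∀ {n} → Graph n → Set₁
IsComparabilityGraph = TransitiveOrientation

-- Subgraphs are taken on the full vertex set: adding isolated vertices changes
-- neither the edge set nor being a comparability graph.
_IsSubgraphOf_ : ∀ {n} → Graph n → Graph n → Set
H IsSubgraphOf G = Edge H ⇒ Edge G

record ComparabilityDecomposition {n} (G : Graph n) (m : ℕ) : Set₁ where
  field
    part          : Fin m → Graph n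
    subgraph      : ∀ i → part i IsSubgraphOf G
    comparability : ∀ i → IsComparabilityGraph (part i)
    disjoint      : ∀ {i j} → i ≢ j →
                    ∀ {u v} → Edge (part i) u v → ¬ Edge (part j) u v
    covers        : ∀ {u v} → Edge G u v → ∃[ i ] Edge (part i) u v

-- p(G) = m
record IsPartitionNumber {n} (G : Graph n) (m : ℕ) : Set₁ where
  field
    attained : ComparabilityDecomposition G m
    minimal  : ∀ k → ComparabilityDecomposition G k → m ≤ k

{-# OPTIONS --safe #-}

-- Edges between V₁ and V₂ form a bipartite graph, which is a comparability
-- graph.  The remaining edges form a disjoint union of complete graphs or, when
-- the complement has the split form, a complete multipartite graph on V₂; both
-- are comparability graphs.  The exact value of p(G) is then found by deciding
-- whether G is edgeless and, by exhausting finitely many orientations, whether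
-- it is a comparability graph.
module Submission where

open import Defs
open import Data.Bool.Base using (Bool; true; false; if_then_else_)
open import Data.Fin.Base using (Fin; zero; suc; toℕ; combine; remQuot)
open import Data.Fin.Subset using (Subset; _∈_; ∁)
open import Data.Fin.Subset.Properties using (_∈?_; anySubset?; x∉p⇒x∈∁p; x∈∁p⇒x∉p)
open import Data.Nat.Base using (ℕ; zero; suc; _*_; _≤_; _<_; z≤n; s≤s)
open import Data.Product.Base using (∃-syntax; _×_; _,_; proj₁; proj₂; uncurry)
open import Data.Sum.Base using (_⊎_; inj₁; inj₂)
open import Data.Vec.Base using (lookup; tabulate)
open import Data.Vec.Properties using ([]=⇒lookup; lookup⇒[]=; lookup∘tabulate)
open import Function.Base using (_∘_; id)
open import Function.Bundles using (Equivalence)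
open import Level using (0ℓ)
open import Relation.Binary.Core using (Rel)
open import Relation.Binary.Definitions
  using (Symmetric; Decidable; tri<; tri≈; tri>)
open import Relation.Binary.PropositionalEquality
  using (_≡_; _≢_; refl; sym; trans; cong; ≢-sym)
open import Relation.Nullary.Decidable
  using (Dec; yes; no; does; map′; dec-true; decidable-stable; ¬?; _×-dec_; _⊎-dec_; _→-dec_)
open import Relation.Nullary.Negation using (¬_; contradiction)
import Data.Bool.Properties as Bool
import Data.Fin.Properties as Fin
import Data.Nat.Properties as ℕ
import Data.Sum.Base as Sum

private
  variable
    n : ℕ

-- Vertex two-colourings and transitive orientations

restrict : (G : Graph n) (R : Rel (Fin n) 0ℓ) → Symmetric R → Decidable R → Graph n
restrict G R R-sym R? = record
  { Edge  = λ u v → Edge G u v × R u v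
  ; sym   = λ (uv , r) → Graph.sym G uv , R-sym r
  ; irr   = λ u≡v (uv , _) → Graph.irr G u≡v uv
  ; edge? = λ u v → Graph.edge? G u v ×-dec R? u v
  }

within : Graph n → (Fin n → Bool) → Graph n
within G c = restrict G (λ u v → c u ≡ c v) sym (λ u v → c u Bool.≟ c v)

across : Graph n → (Fin n → Bool) → Graph n
across G c = restrict G (λ u v → c u ≢ c v) ≢-sym (λ u v → ¬? (c u Bool.≟ c v))

-- Directing each edge towards the larger value of `f` is asymmetric for free, so only closure along
-- increasing paths remains. `f` may repeat values on non-adjacent vertices, so it can be a class
-- index as well as a linear order.
orientAlong : (G : Graph n) (f : Fin n → ℕ) →
  (∀ {u v} → Edge G u v → f u ≢ f v) →
  (∀ {u v w} → Edge G u v → Edge G v w → f u < f v → f v < f w → Edge G u w) →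
  TransitiveOrientation G
orientAlong G f f-proper f-chain = record
  { Arc       = λ u v → Edge G u v × f u < f v
  ; arc⇒edge = proj₁
  ; orients   = orients
  ; asym      = λ (_ , u<v) (_ , v<u) → ℕ.<-asym u<v v<u
  ; trans     = λ (uv , u<v) (vw , v<w) → f-chain uv vw u<v v<w , ℕ.<-trans u<v v<w
  }
  where
  orients : ∀ {u v} → Edge G u v → Edge G u v × f u < f v ⊎ Edge G v u × f v < f u
  orients {u} {v} uv with ℕ.<-cmp (f u) (f v)
  ... | tri< u<v _ _ = inj₁ (uv , u<v)
  ... | tri≈ _ u≡v _ = contradiction u≡v (f-proper uv)
  ... | tri> _ _ v<u = inj₂ (Graph.sym G uv , v<u)

-- With only two ranks there is no directed path of length two, so transitivity is vacuous.
across-comparability : (G : Graph n) (c : Fin n → Bool) → IsComparabilityGraph (across G c)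
across-comparability G c = orientAlong (across G c) (rank ∘ c)
  (λ (_ , cu≢cv) → cu≢cv ∘ rank-injective)
  (λ _ _ u<v v<w → contradiction v<w (no-chain u<v))
  where
  rank : Bool → ℕ
  rank b = if b then 1 else 0

  rank-injective : ∀ {a b} → rank a ≡ rank b → a ≡ b
  rank-injective {false} {false} _ = refl
  rank-injective {true}  {true}  _ = refl

  no-chain : ∀ {a b d} → rank a < rank b → ¬ rank b < rank d
  no-chain {false} {true} {false} _ ()
  no-chain {false} {true} {true}  _ (s≤s ())
  no-chain {true}  {true} (s≤s ())

-- Bichromatic edges always form a comparability graph, so only the monochromatic ones have to be
-- oriented.
colour-decomposition : (G : Graph n) (c : Fin n → Bool) →
  IsComparabilityGraph (within G c) → ComparabilityDecomposition G 2
colour-decomposition G c within-comparability = record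
  { part          = part
  ; subgraph      = λ { zero → proj₁ ; (suc zero) → proj₁ }
  ; comparability = λ { zero → within-comparability ; (suc zero) → across-comparability G c }
  ; disjoint      = disjoint
  ; covers        = covers
  }
  where
  part : Fin 2 → Graph _
  part zero       = within G c
  part (suc zero) = across G c

  disjoint : ∀ {i j} → i ≢ j → ∀ {u v} → Edge (part i) u v → ¬ Edge (part j) u v
  disjoint {zero}     {zero}     i≢j _        _        = i≢j refl
  disjoint {zero}     {suc zero} _   (_ , eq) (_ , ne) = ne eq
  disjoint {suc zero} {zero}     _   (_ , ne) (_ , eq) = ne eq
  disjoint {suc zero} {suc zero} i≢j _        _        = i≢j refl

  covers : ∀ {u v} → Edge G u v → ∃[ i ] Edge (part i) u v
  covers {u} {v} uv with c u Bool.≟ c v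
  ... | yes eq = zero , uv , eq
  ... | no  ne = suc zero , uv , ne

-- Generalized split graphs

∈-resp-lookup : ∀ (S : Subset n) {u v} → lookup S u ≡ lookup S v → u ∈ S → v ∈ S
∈-resp-lookup S {v = v} eq u∈S = lookup⇒[]= v S (trans (sym eq) ([]=⇒lookup u∈S))

∈∁-resp-lookup : ∀ (S : Subset n) {u v} → lookup S u ≡ lookup S v → u ∈ ∁ S → v ∈ ∁ S
∈∁-resp-lookup S eq u∈∁S = x∉p⇒x∈∁p (x∈∁p⇒x∉p u∈∁S ∘ ∈-resp-lookup S (sym eq))

edge⇒≢ : ∀ (G : Graph n) {u v} → Edge G u v → u ≢ v
edge⇒≢ G uv u≡v = Graph.irr G u≡v uv

-- Coloured by membership in `V₁`, the monochromatic graph is a disjoint union of cliques: `V₁` and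
-- the cliques of its complement. Any linear order of the vertices orients it transitively; `toℕ`
-- supplies one.
split-decomposition : (G : Graph n) → HasSplitForm G → ComparabilityDecomposition G 2
split-decomposition G (V₁ , complete , index , cliques) =
  colour-decomposition G (lookup V₁)
    (orientAlong _ toℕ (λ (uv , _) → edge⇒≢ G uv ∘ Fin.toℕ-injective) chain)
  where
  chain : ∀ {u v w} → Edge (within G (lookup V₁)) u v → Edge (within G (lookup V₁)) v w →
          toℕ u < toℕ v → toℕ v < toℕ w → Edge (within G (lookup V₁)) u w
  chain {u} {v} {w} (uv , cu≡cv) (vw , cv≡cw) u<v v<w = edge , cu≡cw
    where
    cu≡cw : lookup V₁ u ≡ lookup V₁ w
    cu≡cw = trans cu≡cv cv≡cw

    u≢w : u ≢ w
    u≢w = Fin.<⇒≢ (ℕ.<-trans u<v v<w)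

    edge : Edge G u w
    edge with u ∈? V₁
    ... | yes u∈V₁ = complete u∈V₁ (∈-resp-lookup V₁ cu≡cw u∈V₁) u≢w
    ... | no  u∉V₁ = Equivalence.from (cliques u∈V₂ w∈V₂ u≢w)
            (trans (Equivalence.to (cliques u∈V₂ v∈V₂ (edge⇒≢ G uv)) uv)
                   (Equivalence.to (cliques v∈V₂ w∈V₂ (edge⇒≢ G vw)) vw))
      where
      u∈V₂ = x∉p⇒x∈∁p u∉V₁
      v∈V₂ = ∈∁-resp-lookup V₁ cu≡cv u∈V₂
      w∈V₂ = ∈∁-resp-lookup V₁ cu≡cw u∈V₂

-- `V₁` is independent in `G`, so monochromatic edges lie in `∁ V₁`. There `G` is complete
-- multipartite with the fibres of `index` as classes, and a linear order of the classes orients it.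
cosplit-decomposition : (G : Graph n) → HasSplitForm (complement G) → ComparabilityDecomposition G 2
cosplit-decomposition G (V₁ , independent , index , multipartite) =
  colour-decomposition G (lookup V₁) (orientAlong _ index proper chain)
  where
  within-V₂ : ∀ {u v} → Edge (within G (lookup V₁)) u v → u ∈ ∁ V₁
  within-V₂ (uv , cu≡cv) = x∉p⇒x∈∁p λ u∈V₁ →
    proj₂ (independent u∈V₁ (∈-resp-lookup V₁ cu≡cv u∈V₁) (edge⇒≢ G uv)) uv

  proper : ∀ {u v} → Edge (within G (lookup V₁)) u v → index u ≢ index v
  proper e@(uv , cu≡cv) iu≡iv = proj₂ (Equivalence.from
    (multipartite u∈V₂ (∈∁-resp-lookup V₁ cu≡cv u∈V₂) (edge⇒≢ G uv)) iu≡iv) uv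
    where u∈V₂ = within-V₂ e

  chain : ∀ {u v w} → Edge (within G (lookup V₁)) u v → Edge (within G (lookup V₁)) v w →
          index u < index v → index v < index w → Edge (within G (lookup V₁)) u w
  chain {u} {v} {w} e@(_ , cu≡cv) (_ , cv≡cw) u<v v<w =
    -- The hypothesis speaks of non-edges, so different indices only refute the absence of an edge;
    -- decidable adjacency gives the edge itself.
    decidable-stable (Graph.edge? G u w) ¬¬edge , cu≡cw
    where
    cu≡cw = trans cu≡cv cv≡cw
    u∈V₂  = within-V₂ e

    iu≢iw : index u ≢ index w
    iu≢iw = ℕ.<⇒≢ (ℕ.<-trans u<v v<w)

    u≢w : u ≢ w
    u≢w = iu≢iw ∘ cong index

    ¬¬edge : ¬ ¬ Edge G u w
    ¬¬edge ¬uw = iu≢iw (Equivalence.to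
      (multipartite u∈V₂ (∈∁-resp-lookup V₁ cu≡cw u∈V₂) u≢w) (u≢w , ¬uw))

gsp-decomposition : (G : Graph n) → GSP G → ComparabilityDecomposition G 2
gsp-decomposition G (inj₁ split)   = split-decomposition G split
gsp-decomposition G (inj₂ cosplit) = cosplit-decomposition G cosplit

-- Deciding comparability by finite search

-- Encoding relations as subsets makes them searchable by anySubset?.
Related : Subset (n * n) → Rel (Fin n) 0ℓ
Related S u v = combine u v ∈ S

-- The laws of `TransitiveOrientation` for a given relation, placed in `Set` and with explicit
-- quantifiers so that `Fin.all?` can decide them.
Orients : Graph n → Rel (Fin n) 0ℓ → Set
Orients G A =
    (∀ u v → A u v → Edge G u v)
  × (∀ u v → Edge G u v → A u v ⊎ A v u)
  × (∀ u v → A u v → ¬ A v u)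
  × (∀ u v w → A u v → A v w → A u w)

orients? : (G : Graph n) {A : Rel (Fin n) 0ℓ} → Decidable A → Dec (Orients G A)
orients? G A? =
        Fin.all? (λ u → Fin.all? λ v → A? u v →-dec Graph.edge? G u v)
  ×-dec Fin.all? (λ u → Fin.all? λ v → Graph.edge? G u v →-dec (A? u v ⊎-dec A? v u))
  ×-dec Fin.all? (λ u → Fin.all? λ v → A? u v →-dec ¬? (A? v u))
  ×-dec Fin.all? (λ u → Fin.all? λ v → Fin.all? λ w → A? u v →-dec (A? v w →-dec A? u w))

orients⇒comparability : (G : Graph n) {A : Rel (Fin n) 0ℓ} → Orients G A → IsComparabilityGraph G
orients⇒comparability G {A} (arc⇒edge , orients , asym , transitive) = record
  { Arc       = A
  ; arc⇒edge = arc⇒edge _ _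
  ; orients   = orients _ _
  ; asym      = asym _ _
  ; trans     = transitive _ _ _
  }

-- The search ranges over encoded relations, which agree with `Arc` only up to logical equivalence;
-- hence the pair of implications.
comparability⇒orients : (G : Graph n) (O : IsComparabilityGraph G) {A : Rel (Fin n) 0ℓ} →
  (∀ {u v} → A u v → TransitiveOrientation.Arc O u v) →
  (∀ {u v} → TransitiveOrientation.Arc O u v → A u v) →
  Orients G A
comparability⇒orients G O to from =
    (λ _ _ → arc⇒edge ∘ to)
  , (λ _ _ → Sum.map from from ∘ orients)
  , (λ _ _ uv vu → asym (to uv) (to vu))
  , (λ _ _ _ uv vw → from (transitive (to uv) (to vw)))
  where open TransitiveOrientation O renaming (trans to transitive)

-- On an edge, `orients` already returns a direction, and asymmetry excludes the other one.
arc? : (G : Graph n) (O : IsComparabilityGraph G) → Decidable (TransitiveOrientation.Arc O)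
arc? G O u v with Graph.edge? G u v
... | no ¬uv = no (¬uv ∘ TransitiveOrientation.arc⇒edge O)
... | yes uv with TransitiveOrientation.orients O uv
...   | inj₁ u→v = yes u→v
...   | inj₂ v→u = no (TransitiveOrientation.asym O v→u)

module _ {A : Rel (Fin n) 0ℓ} (A? : Decidable A) where

  encode : Subset (n * n)
  encode = tabulate (does ∘ uncurry A? ∘ remQuot n)

  lookup-encode : ∀ u v → lookup encode (combine u v) ≡ does (A? u v)
  lookup-encode u v = trans (lookup∘tabulate _ (combine u v))
    (cong (does ∘ uncurry A?) (Fin.remQuot-combine u v))

  encode⁻ : ∀ {u v} → Related encode u v → A u v
  encode⁻ {u} {v} uv with A? u v | trans (sym (lookup-encode u v)) ([]=⇒lookup uv)
  -- The `no` case would equate `false` with `true`, so it is absent.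
  ... | yes a | _ = a

  encode⁺ : ∀ {u v} → A u v → Related encode u v
  encode⁺ {u} {v} a =
    lookup⇒[]= _ encode (trans (lookup-encode u v) (dec-true (A? u v) a))

-- The search is exhaustive because every transitive orientation is a decidable relation and so has
-- an encoding.
comparability? : (G : Graph n) → Dec (IsComparabilityGraph G)
comparability? G = map′
  (λ (_ , o) → orients⇒comparability G o)
  (λ O → encode (arc? G O) ,
         comparability⇒orients G O (encode⁻ (arc? G O)) (encode⁺ (arc? G O)))
  (anySubset? λ S → orients? G {Related S} λ u v → combine u v ∈? S)

-- The exact value of the partition number

edgeless? : (G : Graph n) → Dec (∀ u v → ¬ Edge G u v)
edgeless? G = Fin.all? λ u → Fin.all? λ v → ¬? (Graph.edge? G u v)

edgeless⇒decomposition : (G : Graph n) → (∀ u v → ¬ Edge G u v) → ComparabilityDecomposition G 0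
edgeless⇒decomposition G edgeless = record
  { part          = λ ()
  ; subgraph      = λ ()
  ; comparability = λ ()
  ; disjoint      = λ { {()} }
  ; covers        = λ uv → contradiction uv (edgeless _ _)
  }

decomposition⇒edgeless : (G : Graph n) → ComparabilityDecomposition G 0 → ∀ u v → ¬ Edge G u v
decomposition⇒edgeless G D u v uv with () ← proj₁ (ComparabilityDecomposition.covers D uv)

comparability⇒decomposition : (G : Graph n) → IsComparabilityGraph G → ComparabilityDecomposition G 1
comparability⇒decomposition G O = record
  { part          = λ _ → G
  ; subgraph      = λ _ → id
  ; comparability = λ _ → O
  ; disjoint      = λ { {zero} {zero} i≢j → contradiction refl i≢j }
  ; covers        = zero ,_
  }

-- A single part is contained in `G` and covers it, so both have the same edges and the orientation
-- carries over.
decomposition⇒comparability : (G : Graph n) → ComparabilityDecomposition G 1 → IsComparabilityGraph G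
decomposition⇒comparability G D = record
  { Arc       = Arc
  ; arc⇒edge = subgraph zero ∘ arc⇒edge
  ; orients   = orients ∘ covered
  ; asym      = asym
  ; trans     = transitive
  }
  where
  open ComparabilityDecomposition D
  open TransitiveOrientation (comparability zero) renaming (trans to transitive)

  covered : ∀ {u v} → Edge G u v → Edge (part zero) u v
  covered uv with zero , e ← covers uv = e

-- `D` only bounds the minimum from above; to exhibit it, one decides whether zero parts or one part
-- suffice.
partitionNumber≤2 : (G : Graph n) → ComparabilityDecomposition G 2 →
  ∃[ m ] (IsPartitionNumber G m × m ≤ 2)
partitionNumber≤2 G D with edgeless? G | comparability? G
... | yes edgeless | _ =
  0 , record { attained = edgeless⇒decomposition G edgeless ; minimal = λ _ _ → z≤n } , z≤n
... | no ¬edgeless | yes O =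
  1 , record { attained = comparability⇒decomposition G O ; minimal = minimal } , s≤s z≤n
  where
  minimal : ∀ k → ComparabilityDecomposition G k → 1 ≤ k
  minimal zero    D₀ = contradiction (decomposition⇒edgeless G D₀) ¬edgeless
  minimal (suc _) _  = s≤s z≤n
... | no ¬edgeless | no ¬O =
  2 , record { attained = D ; minimal = minimal } , ℕ.≤-refl
  where
  minimal : ∀ k → ComparabilityDecomposition G k → 2 ≤ k
  minimal zero          D₀ = contradiction (decomposition⇒edgeless G D₀) ¬edgeless
  minimal (suc zero)    D₁ = contradiction (decomposition⇒comparability G D₁) ¬O
  minimal (suc (suc _)) _  = s≤s (s≤s z≤n)

theorem3 : ∀ {n : ℕ} (G : Graph n) → GSP G → ∃[ m ] (IsPartitionNumber G m × m ≤ 2)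
theorem3 G gsp = partitionNumber≤2 G (gsp-decomposition G gsp)
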